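{- For all integers $t\ge 0$ and $n\ge 1$, the following identity of rational functions in $x$ holds: $$\underline{N}^{(t)}_{n+1}(x)=\frac{a_0+a_1x+a_2x^2}{(n+t+3)(n+1)(c_0+c_1x)}\,\underline{N}^{(t)}_{n}(x)-\frac{n(n+t)(x-1)^2(b_0+b_1x)}{(n+t+3)(n+1)(c_0+c_1x)}\,\underline{N}^{(t)}_{n-1}(x),$$ where $$\begin{aligned} a_0&=-\bigl(2n^3+(2t+5)n^2+(2t+3)n\bigr),\\ a_1&=2t(t+2)n^3+3t(t+2)^2n^2+t(t+2)(t^2+5t+5)n+\tfrac12 t(t+1)(t+2)(t+3),\\ a_2&=(t+1)\Bigl((2t+2)n^3+(3t^2+9t+5)n^2+(2t+3)(t^2+3t+1)n+\tfrac12 t(t+1)(t+2)(t+3)\Bigr),\\ b_0&=-(n+1),\\ b_1&=(t+1)^2n+\tfrac12(t+1)(t^2+4t+2),\\ c_0&=-n,\\ c_1&=(t+1)^2n+\tfrac12 t(t+1)(t+2). \end{aligned}$$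
   Context: For nonnegative integers $n,m$ let $$N_{n,m}(x)=\sum_{k=0}^{n}\left(\binom{n}{k}\binom{m}{k}-\binom{n}{k+1}\binom{m}{k-1}\right)x^k,$$ where $\binom{a}{b}=0$ if $b<0$ or $b>a$. For nonnegative integers $t$ and $n$, put $\underline{N}^{(t)}_n(x)=N_{n,n+t}(x)$. -}

module Defs where

open import Data.Integer as ℤ using (ℤ; +_; -[1+_])
open import Data.List using (List; []; _∷_; map; upTo)
open import Data.Nat as ℕ using (ℕ; zero; suc)
import Data.Nat.Properties as ℕ
open import Data.Nat.Combinatorics using (_C_)
open import Data.Rational as ℚ using (ℚ; 0ℚ; 1ℚ; ½; ≢-nonZero)
open import Data.Rational.Literals using (fromℤ)
open import Data.Rational.Properties
open import Function using (_∘_)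
open import Relation.Nullary using (¬_; yes; no; contradiction)
open import Relation.Binary.PropositionalEquality

-- Polynomials in ℚ[x]: coefficients in order of increasing degree; trailing zeros
-- are allowed, so equality of polynomials is _≈_ and not _≡_.

Poly : Set
Poly = List ℚ

coeff : Poly → ℕ → ℚ
coeff []      _       = 0ℚ
coeff (a ∷ p) zero    = a
coeff (a ∷ p) (suc k) = coeff p k

infix  4 _≈_
infixl 6 _+ₚ_ _-ₚ_
infixl 7 _*ₚ_
infixr 8 _·_

_≈_ : Poly → Poly → Set
p ≈ q = ∀ k → coeff p k ≡ coeff q k

0ₚ 1ₚ : Poly
0ₚ = []
1ₚ = 1ℚ ∷ []

_+ₚ_ : Poly → Poly → Poly
[]      +ₚ q       = q
(a ∷ p) +ₚ []      = a ∷ p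
(a ∷ p) +ₚ (b ∷ q) = (a ℚ.+ b) ∷ (p +ₚ q)

_·_ : ℚ → Poly → Poly
c · p = map (c ℚ.*_) p

_-ₚ_ : Poly → Poly → Poly
p -ₚ q = p +ₚ (ℚ.- 1ℚ) · q

_*ₚ_ : Poly → Poly → Poly
[]      *ₚ q = []
(a ∷ p) *ₚ q = a · q +ₚ (0ℚ ∷ p *ₚ q)

record NonZeroₚ (p : Poly) : Set where
  constructor nonZeroₚ
  field ≉0ₚ : ¬ p ≈ 0ₚ

-- ℚ[x] has no zero divisors; needed for products of denominators to be
-- admissible denominators in RatFun below.

coeff-+ : ∀ p q k → coeff (p +ₚ q) k ≡ coeff p k ℚ.+ coeff q k
coeff-+ []      q       k       = sym (+-identityˡ _)
coeff-+ (a ∷ p) []      k       = sym (+-identityʳ _)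
coeff-+ (a ∷ p) (b ∷ q) zero    = refl
coeff-+ (a ∷ p) (b ∷ q) (suc k) = coeff-+ p q k

coeff-· : ∀ c p k → coeff (c · p) k ≡ c ℚ.* coeff p k
coeff-· c []      k       = sym (*-zeroʳ c)
coeff-· c (a ∷ p) zero    = refl
coeff-· c (a ∷ p) (suc k) = coeff-· c p k

coeff-*-shiftˡ : ∀ p q k → coeff ((0ℚ ∷ p) *ₚ q) (suc k) ≡ coeff (p *ₚ q) k
coeff-*-shiftˡ p q k = begin
  coeff (0ℚ · q +ₚ (0ℚ ∷ p *ₚ q)) (suc k)         ≡⟨ coeff-+ (0ℚ · q) _ (suc k) ⟩
  coeff (0ℚ · q) (suc k) ℚ.+ coeff (p *ₚ q) k     ≡⟨ cong (ℚ._+ coeff (p *ₚ q) k) (coeff-· 0ℚ q (suc k)) ⟩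
  0ℚ ℚ.* coeff q (suc k) ℚ.+ coeff (p *ₚ q) k     ≡⟨ cong (ℚ._+ coeff (p *ₚ q) k) (*-zeroˡ (coeff q (suc k))) ⟩
  0ℚ ℚ.+ coeff (p *ₚ q) k                         ≡⟨ +-identityˡ _ ⟩
  coeff (p *ₚ q) k                                ∎
  where open ≡-Reasoning

coeff-*-shiftʳ₀ : ∀ p q → coeff (p *ₚ (0ℚ ∷ q)) 0 ≡ 0ℚ
coeff-*-shiftʳ₀ []      q = refl
coeff-*-shiftʳ₀ (a ∷ p) q = trans (+-identityʳ _) (*-zeroʳ a)

coeff-*-shiftʳ : ∀ p q k → coeff (p *ₚ (0ℚ ∷ q)) (suc k) ≡ coeff (p *ₚ q) k
coeff-*-shiftʳ []      q k = refl
coeff-*-shiftʳ (a ∷ p) q k = begin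
  coeff (a · q +ₚ p *ₚ (0ℚ ∷ q)) k                 ≡⟨ coeff-+ (a · q) _ k ⟩
  coeff (a · q) k ℚ.+ coeff (p *ₚ (0ℚ ∷ q)) k      ≡⟨ cong (coeff (a · q) k ℚ.+_) (shift k) ⟩
  coeff (a · q) k ℚ.+ coeff (0ℚ ∷ p *ₚ q) k        ≡⟨ coeff-+ (a · q) _ k ⟨
  coeff (a · q +ₚ (0ℚ ∷ p *ₚ q)) k                 ∎
  where
  open ≡-Reasoning
  shift : ∀ k → coeff (p *ₚ (0ℚ ∷ q)) k ≡ coeff (0ℚ ∷ p *ₚ q) k
  shift zero    = coeff-*-shiftʳ₀ p q
  shift (suc k) = coeff-*-shiftʳ p q k

*-cancel-0 : ∀ {a b} → a ≢ 0ℚ → a ℚ.* b ≡ 0ℚ → b ≡ 0ℚ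
*-cancel-0 {a} {b} a≢0 ab≡0 = begin
  b                     ≡⟨ *-identityˡ b ⟨
  1ℚ ℚ.* b              ≡⟨ cong (ℚ._* b) (*-inverseˡ a) ⟨
  ℚ.1/ a ℚ.* a ℚ.* b    ≡⟨ *-assoc (ℚ.1/ a) a b ⟩
  ℚ.1/ a ℚ.* (a ℚ.* b)  ≡⟨ cong (ℚ.1/ a ℚ.*_) ab≡0 ⟩
  ℚ.1/ a ℚ.* 0ℚ         ≡⟨ *-zeroʳ (ℚ.1/ a) ⟩
  0ℚ                    ∎
  where
  open ≡-Reasoning
  instance a-nonZero = ≢-nonZero a≢0

*ₚ-cancel-unit : ∀ {a} p q → a ≢ 0ℚ → (a ∷ p) *ₚ q ≈ 0ₚ → q ≈ 0ₚ
*ₚ-cancel-unit p []      a≢0 pq≈0 k = refl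
*ₚ-cancel-unit {a} p (b ∷ q) a≢0 pq≈0
  with refl ← *-cancel-0 {a} {b} a≢0 (trans (sym (+-identityʳ _)) (pq≈0 0)) = λ where
    zero    → refl
    (suc k) → *ₚ-cancel-unit p q a≢0
                (λ j → trans (sym (coeff-*-shiftʳ (a ∷ p) q j)) (pq≈0 (suc j))) k

*ₚ-cancel-0 : ∀ p q → ¬ q ≈ 0ₚ → p *ₚ q ≈ 0ₚ → p ≈ 0ₚ
*ₚ-cancel-0 []      q q≉0 pq≈0 k = refl
*ₚ-cancel-0 (a ∷ p) q q≉0 pq≈0 with a ≟ 0ℚ
... | no a≢0   = contradiction (*ₚ-cancel-unit p q a≢0 pq≈0) q≉0
... | yes refl = λ where
    zero    → refl
    (suc k) → *ₚ-cancel-0 p q q≉0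
                (λ j → trans (sym (coeff-*-shiftˡ p q j)) (pq≈0 (suc j))) k

*ₚ-nonZero : ∀ {p q} → NonZeroₚ p → NonZeroₚ q → NonZeroₚ (p *ₚ q)
*ₚ-nonZero {p} {q} (nonZeroₚ p≉0) (nonZeroₚ q≉0) =
  nonZeroₚ (p≉0 ∘ *ₚ-cancel-0 p q q≉0)

instance
  1ₚ-nonZero : NonZeroₚ 1ₚ
  1ₚ-nonZero = nonZeroₚ λ 1≈0 → contradiction (1≈0 0) λ ()

infix  4 _≃_
infixl 6 _-ᵣ_
infixl 7 _*ᵣ_
infixl 8 _/_

record RatFun : Set where
  constructor _/_
  field
    num : Poly
    den : Poly
    .{{den-nonZero}} : NonZeroₚ den

open RatFun

_≃_ : RatFun → RatFun → Set
f ≃ g = num f *ₚ den g ≈ num g *ₚ den f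

fromPoly : Poly → RatFun
fromPoly p = p / 1ₚ

_-ᵣ_ : RatFun → RatFun → RatFun
_/_ p q {{q≉0}} -ᵣ _/_ r s {{s≉0}} =
  _/_ (p *ₚ s -ₚ r *ₚ q) (q *ₚ s) {{*ₚ-nonZero q≉0 s≉0}}

_*ᵣ_ : RatFun → RatFun → RatFun
_/_ p q {{q≉0}} *ᵣ _/_ r s {{s≉0}} =
  _/_ (p *ₚ r) (q *ₚ s) {{*ₚ-nonZero q≉0 s≉0}}

-- The lower index is an integer because k - 1 = -1 occurs; _C_ already
-- vanishes when the lower index exceeds the upper one.

binom : ℕ → ℤ → ℤ
binom a (+ b)    = + (a C b)
binom a -[1+ _ ] = + 0

N-coeff : ℕ → ℕ → ℕ → ℤ
N-coeff n m k =
  binom n (+ k) ℤ.* binom m (+ k)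
    ℤ.- binom n (+ k ℤ.+ + 1) ℤ.* binom m (+ k ℤ.- + 1)

N : ℕ → ℕ → Poly
N n m = map (fromℤ ∘ N-coeff n m) (upTo (suc n))

N̲ : ℕ → ℕ → Poly
N̲ t n = N n (n ℕ.+ t)

fromℕ : ℕ → ℚ
fromℕ n = fromℤ (+ n)

x-1 : Poly
x-1 = ℚ.- 1ℚ ∷ 1ℚ ∷ []

-- Subexpressions with nonnegative integer coefficients are computed in ℕ before
-- being embedded in ℚ.

module _ (t n : ℕ) where

  open import Data.Nat using (_+_; _*_; _^_)

  a₀ a₁ a₂ b₀ b₁ c₀ c₁ : ℚ

  a₀ = ℚ.- fromℕ (2 * n ^ 3 + (2 * t + 5) * n ^ 2 + (2 * t + 3) * n)

  a₁ = fromℕ (2 * t * (t + 2) * n ^ 3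
              + 3 * t * (t + 2) ^ 2 * n ^ 2
              + t * (t + 2) * (t ^ 2 + 5 * t + 5) * n)
       ℚ.+ ½ ℚ.* fromℕ (t * (t + 1) * (t + 2) * (t + 3))

  a₂ = fromℕ (t + 1) ℚ.*
       (fromℕ ((2 * t + 2) * n ^ 3
               + (3 * t ^ 2 + 9 * t + 5) * n ^ 2
               + (2 * t + 3) * (t ^ 2 + 3 * t + 1) * n)
        ℚ.+ ½ ℚ.* fromℕ (t * (t + 1) * (t + 2) * (t + 3)))

  b₀ = ℚ.- fromℕ (n + 1)

  b₁ = fromℕ ((t + 1) ^ 2 * n)
       ℚ.+ ½ ℚ.* fromℕ ((t + 1) * (t ^ 2 + 4 * t + 2))

  c₀ = ℚ.- fromℕ n

  c₁ = fromℕ ((t + 1) ^ 2 * n)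
       ℚ.+ ½ ℚ.* fromℕ (t * (t + 1) * (t + 2))

  a-numerator b-numerator denominator : Poly

  a-numerator = a₀ ∷ a₁ ∷ a₂ ∷ []

  b-numerator = fromℕ (n * (n + t)) · (x-1 *ₚ x-1 *ₚ (b₀ ∷ b₁ ∷ []))

  denominator = fromℕ ((n + t + 3) * (n + 1)) · (c₀ ∷ c₁ ∷ [])

-- The constant term is -(n+t+3)(n+1)n, which is nonzero for n ≥ 1.

instance
  denominator-nonZero : ∀ {t n} .{{_ : ℕ.NonZero n}} → NonZeroₚ (denominator t n)
  denominator-nonZero {t} {n@(suc _)} = nonZeroₚ λ d≈0 →
    contradiction (*-cancel-0 {b = c₀ t n} (s≢0 (n ℕ.+ t) n) (d≈0 0)) λ ()
    where
    s≢0 : ∀ i j → fromℕ ((i ℕ.+ 3) ℕ.* (j ℕ.+ 1)) ≢ 0ℚ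
    s≢0 i j rewrite ℕ.+-comm i 3 | ℕ.+-comm j 1 = λ ()

module Submission where

-- With m = n + t, the coefficients of N_{n,m} have the closed form
--   (n+1)(m+1) [xⁱ] N_{n,m} = (m + 1 + i t) C(n+1, i+1) C(m+1, i),
-- valid for every integer i. Compare the coefficients of x^(j+3) on both sides of the
-- recurrence, cleared of denominators: each of the nine coefficients involved is an explicit
-- rational multiple of C(n+3, j+4) C(m+3, j+3), because C(a, i) is a rational multiple of both
-- C(a+1, i) and C(a+1, i+1). The recurrence thus becomes a polynomial identity in n, t and j,
-- which a ring solver verifies. Integer indices spare the case distinctions at the ends.

open import Defs
open import Data.Nat using (ℕ; suc; pred; NonZero)
open import Algebra.Bundles using (CommutativeRing)
import Algebra.Properties.CommutativeSemigroup
import Algebra.Properties.Group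
open import Data.Integer as ℤ using (ℤ; +_; -[1+_])
import Data.Integer.Properties as ℤ
open import Data.List using ([]; _∷_; applyUpTo)
open import Data.List.Properties using (map-upTo)
open import Data.Nat as ℕ using (zero)
open import Data.Nat.Combinatorics using (_C_; nC1≡n; k>n⇒nCk≡0; nCk+nC[k+1]≡[n+1]C[k+1])
import Data.Nat.Properties as ℕ
import Data.Nat.Solver as ℕSolver
open import Data.Rational as ℚ using (ℚ; 0ℚ; 1ℚ; ½; _+_; _*_; -_)
open import Data.Rational.Literals using (fromℤ)
open import Data.Rational.Properties
import Data.Rational.Solver as ℚSolver
open import Function using (_∘_; id)
open import Level using (0ℓ)
open import Relation.Binary.Bundles using (Setoid)
open import Relation.Binary.PropositionalEquality
import Relation.Binary.Reasoning.Setoid as ≋-Reasoning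

open Algebra.Properties.CommutativeSemigroup (CommutativeRing.+-commutativeSemigroup +-*-commutativeRing)
  using () renaming (interchange to +-interchange; x∙yz≈y∙xz to +-x∙yz≈y∙xz)
open Algebra.Properties.CommutativeSemigroup (CommutativeRing.*-commutativeSemigroup +-*-commutativeRing)
  using () renaming (interchange to *-interchange)

-- The ring ℚ[x]

-- p ≈ q unfolds to a function type from which Agda cannot recover p and q; the record
-- makes them inferable.
infix 4 _≋_
record _≋_ (p q : Poly) : Set where
  constructor coeffwise
  field at : p ≈ q
open _≋_

≋-setoid : Setoid 0ℓ 0ℓ
≋-setoid = record
  { Carrier = Poly
  ; _≈_ = _≋_
  ; isEquivalence = record
    { refl  = coeffwise λ _ → refl
    ; sym   = λ p≋q → coeffwise λ k → sym (at p≋q k)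
    ; trans = λ p≋q q≋r → coeffwise λ k → trans (at p≋q k) (at q≋r k)
    }
  }

private module ≋ = Setoid ≋-setoid

0∷-cong : ∀ {p q} → p ≋ q → 0ℚ ∷ p ≋ 0ℚ ∷ q
0∷-cong p≋q = coeffwise λ where
  zero    → refl
  (suc k) → at p≋q k

0∷-+ : ∀ p q k → coeff (0ℚ ∷ p +ₚ q) k ≡ coeff (0ℚ ∷ p) k + coeff (0ℚ ∷ q) k
0∷-+ p q zero    = refl
0∷-+ p q (suc k) = coeff-+ p q k

0∷-· : ∀ c p k → coeff (0ℚ ∷ c · p) k ≡ c * coeff (0ℚ ∷ p) k
0∷-· c p zero    = sym (*-zeroʳ c)
0∷-· c p (suc k) = coeff-· c p k

coeff-∷-* : ∀ a p q k → coeff ((a ∷ p) *ₚ q) k ≡ a * coeff q k + coeff (0ℚ ∷ p *ₚ q) k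
coeff-∷-* a p q k = trans (coeff-+ (a · q) (0ℚ ∷ p *ₚ q) k)
                          (cong (_+ coeff (0ℚ ∷ p *ₚ q) k) (coeff-· a q k))

+ₚ-cong : ∀ {p p′ q q′} → p ≋ p′ → q ≋ q′ → p +ₚ q ≋ p′ +ₚ q′
+ₚ-cong {p} {p′} {q} {q′} p≋p′ q≋q′ = coeffwise λ k →
  trans (coeff-+ p q k) (trans (cong₂ _+_ (at p≋p′ k) (at q≋q′ k)) (sym (coeff-+ p′ q′ k)))

·-cong : ∀ c {p q} → p ≋ q → c · p ≋ c · q
·-cong c {p} {q} p≋q = coeffwise λ k →
  trans (coeff-· c p k) (trans (cong (c *_) (at p≋q k)) (sym (coeff-· c q k)))

*ₚ-congˡ : ∀ p {q q′} → q ≋ q′ → p *ₚ q ≋ p *ₚ q′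
*ₚ-congˡ []      q≋q′ = ≋.refl
*ₚ-congˡ (a ∷ p) q≋q′ = +ₚ-cong (·-cong a q≋q′) (0∷-cong (*ₚ-congˡ p q≋q′))

*ₚ-zeroʳ : ∀ p → p *ₚ 0ₚ ≈ 0ₚ
*ₚ-zeroʳ []      k       = refl
*ₚ-zeroʳ (a ∷ p) zero    = refl
*ₚ-zeroʳ (a ∷ p) (suc k) = *ₚ-zeroʳ p k

-- The defining clause of the product mirrored to the right factor, which is what the induction for
-- commutativity needs.
*ₚ-∷ʳ : ∀ p b q → p *ₚ (b ∷ q) ≈ b · p +ₚ (0ℚ ∷ p *ₚ q)
*ₚ-∷ʳ []      b q zero    = refl
*ₚ-∷ʳ []      b q (suc k) = refl
*ₚ-∷ʳ (a ∷ p) b q zero    = cong (_+ 0ℚ) (*-comm a b)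
*ₚ-∷ʳ (a ∷ p) b q (suc k) = begin
  coeff (a · q +ₚ p *ₚ (b ∷ q)) k                          ≡⟨ coeff-+ (a · q) (p *ₚ (b ∷ q)) k ⟩
  coeff (a · q) k + coeff (p *ₚ (b ∷ q)) k                 ≡⟨ cong (_+_ (coeff (a · q) k)) (*ₚ-∷ʳ p b q k) ⟩
  coeff (a · q) k + coeff (b · p +ₚ (0ℚ ∷ p *ₚ q)) k       ≡⟨ cong (_+_ (coeff (a · q) k)) (coeff-+ (b · p) (0ℚ ∷ p *ₚ q) k) ⟩
  coeff (a · q) k + (coeff (b · p) k + coeff (0ℚ ∷ p *ₚ q) k)
    ≡⟨ +-x∙yz≈y∙xz (coeff (a · q) k) (coeff (b · p) k) (coeff (0ℚ ∷ p *ₚ q) k) ⟩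
  coeff (b · p) k + (coeff (a · q) k + coeff (0ℚ ∷ p *ₚ q) k)
    ≡⟨ cong (_+_ (coeff (b · p) k)) (coeff-+ (a · q) (0ℚ ∷ p *ₚ q) k) ⟨
  coeff (b · p) k + coeff ((a ∷ p) *ₚ q) k                 ≡⟨ coeff-+ (b · p) ((a ∷ p) *ₚ q) k ⟨
  coeff (b · p +ₚ (a ∷ p) *ₚ q) k                          ∎
  where open ≡-Reasoning

*ₚ-comm : ∀ p q → p *ₚ q ≋ q *ₚ p
*ₚ-comm []      q = coeffwise λ k → sym (*ₚ-zeroʳ q k)
*ₚ-comm (a ∷ p) q = begin
  a · q +ₚ (0ℚ ∷ p *ₚ q)  ≈⟨ +ₚ-cong ≋.refl (0∷-cong (*ₚ-comm p q)) ⟩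
  a · q +ₚ (0ℚ ∷ q *ₚ p)  ≈⟨ coeffwise (*ₚ-∷ʳ q a p) ⟨
  q *ₚ (a ∷ p)            ∎
  where open ≋-Reasoning ≋-setoid

-- Equal polynomials may be lists of different lengths, so recursion on the left factors is awkward;
-- commutativity moves them to the right.
*ₚ-congʳ : ∀ q {p p′} → p ≋ p′ → p *ₚ q ≋ p′ *ₚ q
*ₚ-congʳ q {p} {p′} p≋p′ = begin
  p *ₚ q   ≈⟨ *ₚ-comm p q ⟩
  q *ₚ p   ≈⟨ *ₚ-congˡ q p≋p′ ⟩
  q *ₚ p′  ≈⟨ *ₚ-comm q p′ ⟩
  p′ *ₚ q  ∎
  where open ≋-Reasoning ≋-setoid

*ₚ-distribʳ-+ₚ : ∀ r p q → (p +ₚ q) *ₚ r ≋ p *ₚ r +ₚ q *ₚ r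
*ₚ-distribʳ-+ₚ r []      q       = ≋.refl
*ₚ-distribʳ-+ₚ r (a ∷ p) []      = coeffwise λ k →
  sym (trans (coeff-+ ((a ∷ p) *ₚ r) [] k) (+-identityʳ (coeff ((a ∷ p) *ₚ r) k)))
*ₚ-distribʳ-+ₚ r (a ∷ p) (b ∷ q) = coeffwise λ k → begin
  coeff ((a + b ∷ p +ₚ q) *ₚ r) k
    ≡⟨ coeff-∷-* (a + b) (p +ₚ q) r k ⟩
  (a + b) * coeff r k + coeff (0ℚ ∷ (p +ₚ q) *ₚ r) k
    ≡⟨ cong (_+_ ((a + b) * coeff r k)) (at (0∷-cong (*ₚ-distribʳ-+ₚ r p q)) k) ⟩
  (a + b) * coeff r k + coeff (0ℚ ∷ p *ₚ r +ₚ q *ₚ r) k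
    ≡⟨ cong (_+_ ((a + b) * coeff r k)) (0∷-+ (p *ₚ r) (q *ₚ r) k) ⟩
  (a + b) * coeff r k + (coeff (0ℚ ∷ p *ₚ r) k + coeff (0ℚ ∷ q *ₚ r) k)
    ≡⟨ cong (_+ (coeff (0ℚ ∷ p *ₚ r) k + coeff (0ℚ ∷ q *ₚ r) k)) (*-distribʳ-+ (coeff r k) a b) ⟩
  (a * coeff r k + b * coeff r k) + (coeff (0ℚ ∷ p *ₚ r) k + coeff (0ℚ ∷ q *ₚ r) k)
    ≡⟨ +-interchange (a * coeff r k) (b * coeff r k) (coeff (0ℚ ∷ p *ₚ r) k) (coeff (0ℚ ∷ q *ₚ r) k) ⟩
  (a * coeff r k + coeff (0ℚ ∷ p *ₚ r) k) + (b * coeff r k + coeff (0ℚ ∷ q *ₚ r) k)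
    ≡⟨ cong₂ _+_ (coeff-∷-* a p r k) (coeff-∷-* b q r k) ⟨
  coeff ((a ∷ p) *ₚ r) k + coeff ((b ∷ q) *ₚ r) k
    ≡⟨ coeff-+ ((a ∷ p) *ₚ r) ((b ∷ q) *ₚ r) k ⟨
  coeff ((a ∷ p) *ₚ r +ₚ (b ∷ q) *ₚ r) k
    ∎
  where open ≡-Reasoning

·-*ₚ-assoc : ∀ c p q → (c · p) *ₚ q ≋ c · (p *ₚ q)
·-*ₚ-assoc c []      q = ≋.refl
·-*ₚ-assoc c (a ∷ p) q = coeffwise λ k → begin
  coeff ((c * a ∷ c · p) *ₚ q) k
    ≡⟨ coeff-∷-* (c * a) (c · p) q k ⟩
  c * a * coeff q k + coeff (0ℚ ∷ (c · p) *ₚ q) k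
    ≡⟨ cong (_+_ (c * a * coeff q k)) (at (0∷-cong (·-*ₚ-assoc c p q)) k) ⟩
  c * a * coeff q k + coeff (0ℚ ∷ c · (p *ₚ q)) k
    ≡⟨ cong₂ _+_ (*-assoc c a (coeff q k)) (0∷-· c (p *ₚ q) k) ⟩
  c * (a * coeff q k) + c * coeff (0ℚ ∷ p *ₚ q) k
    ≡⟨ *-distribˡ-+ c (a * coeff q k) (coeff (0ℚ ∷ p *ₚ q) k) ⟨
  c * (a * coeff q k + coeff (0ℚ ∷ p *ₚ q) k)
    ≡⟨ cong (c *_) (coeff-∷-* a p q k) ⟨
  c * coeff ((a ∷ p) *ₚ q) k
    ≡⟨ coeff-· c ((a ∷ p) *ₚ q) k ⟨
  coeff (c · ((a ∷ p) *ₚ q)) k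
    ∎
  where open ≡-Reasoning

0∷-*ₚ : ∀ p q → (0ℚ ∷ p) *ₚ q ≋ 0ℚ ∷ p *ₚ q
0∷-*ₚ p q = coeffwise λ k → trans (coeff-∷-* 0ℚ p q k)
                    (trans (cong (_+ coeff (0ℚ ∷ p *ₚ q) k) (*-zeroˡ (coeff q k)))
                           (+-identityˡ (coeff (0ℚ ∷ p *ₚ q) k)))

*ₚ-assoc : ∀ p q r → (p *ₚ q) *ₚ r ≋ p *ₚ (q *ₚ r)
*ₚ-assoc []      q r = ≋.refl
*ₚ-assoc (a ∷ p) q r = begin
  (a · q +ₚ (0ℚ ∷ p *ₚ q)) *ₚ r            ≈⟨ *ₚ-distribʳ-+ₚ r (a · q) (0ℚ ∷ p *ₚ q) ⟩
  (a · q) *ₚ r +ₚ (0ℚ ∷ p *ₚ q) *ₚ r       ≈⟨ +ₚ-cong (·-*ₚ-assoc a q r) (0∷-*ₚ (p *ₚ q) r) ⟩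
  a · (q *ₚ r) +ₚ (0ℚ ∷ (p *ₚ q) *ₚ r)     ≈⟨ +ₚ-cong ≋.refl (0∷-cong (*ₚ-assoc p q r)) ⟩
  a · (q *ₚ r) +ₚ (0ℚ ∷ p *ₚ (q *ₚ r))     ∎
  where open ≋-Reasoning ≋-setoid

*ₚ-identityʳ : ∀ p → p *ₚ 1ₚ ≈ p
*ₚ-identityʳ []      k       = refl
*ₚ-identityʳ (a ∷ p) zero    = trans (+-identityʳ (a * 1ℚ)) (*-identityʳ a)
*ₚ-identityʳ (a ∷ p) (suc k) = *ₚ-identityʳ p k

-- Clearing denominators of rational functions

module _ (d a b : Poly) .{{_ : NonZeroₚ d}} where

  -- Both fractions on the right have denominator `d *ₚ 1ₚ`, and `_-ᵣ_` squares it instead of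
  -- keeping it. The claim is therefore the hypothesis multiplied by one further factor `D`.
  cross-multiply : ∀ p q r → d *ₚ p ≋ a *ₚ q -ₚ b *ₚ r →
                   fromPoly p ≃ (a / d) *ᵣ fromPoly q -ᵣ (b / d) *ᵣ fromPoly r
  cross-multiply p q r dp≋aq−br = at (begin
    p *ₚ (D *ₚ D)                                       ≈⟨ *ₚ-assoc p D D ⟨
    (p *ₚ D) *ₚ D                                       ≈⟨ *ₚ-congʳ D pD≋aq−br ⟩
    (a *ₚ q +ₚ (- 1ℚ) · (b *ₚ r)) *ₚ D                  ≈⟨ *ₚ-distribʳ-+ₚ D (a *ₚ q) ((- 1ℚ) · (b *ₚ r)) ⟩
    (a *ₚ q) *ₚ D +ₚ ((- 1ℚ) · (b *ₚ r)) *ₚ D           ≈⟨ +ₚ-cong ≋.refl (·-*ₚ-assoc (- 1ℚ) (b *ₚ r) D) ⟩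
    (a *ₚ q) *ₚ D -ₚ (b *ₚ r) *ₚ D                      ≈⟨ coeffwise (*ₚ-identityʳ ((a *ₚ q) *ₚ D -ₚ (b *ₚ r) *ₚ D)) ⟨
    ((a *ₚ q) *ₚ D -ₚ (b *ₚ r) *ₚ D) *ₚ 1ₚ              ∎)
    where
    open ≋-Reasoning ≋-setoid
    D : Poly
    D = d *ₚ 1ₚ
    pD≋aq−br : p *ₚ D ≋ a *ₚ q -ₚ b *ₚ r
    pD≋aq−br = begin
      p *ₚ D                ≈⟨ *ₚ-congˡ p (coeffwise (*ₚ-identityʳ d)) ⟩
      p *ₚ d                ≈⟨ *ₚ-comm p d ⟩
      d *ₚ p                ≈⟨ dp≋aq−br ⟩
      a *ₚ q -ₚ b *ₚ r      ∎

open ≡-Reasoning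

-- Binomial coefficients with an integer lower index

fromℤ-+ : ∀ i j → fromℤ (i ℤ.+ j) ≡ fromℤ i + fromℤ j
fromℤ-+ i j = begin
  fromℤ (i ℤ.+ j)    ≡⟨ ↥p/↧p≡p (fromℤ (i ℤ.+ j)) ⟨
  -- The sum of two fractions over 1 unfolds to `(i * 1 + j * 1) / 1`.
  (i ℤ.+ j) ℚ./ 1    ≡⟨ cong₂ (λ x y → (x ℤ.+ y) ℚ./ 1) (ℤ.*-identityʳ i) (ℤ.*-identityʳ j) ⟨
  fromℤ i + fromℤ j  ∎

fromℤ-* : ∀ i j → fromℤ (i ℤ.* j) ≡ fromℤ i * fromℤ j
fromℤ-* i j = sym (↥p/↧p≡p (fromℤ (i ℤ.* j)))

fromℤ-neg : ∀ i → fromℤ (ℤ.- i) ≡ - fromℤ i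
fromℤ-neg (+ zero)    = refl
fromℤ-neg ℤ.+[1+ n ]  = refl
fromℤ-neg -[1+ n ]    = refl

fromℕ-+ : ∀ m n → fromℕ (m ℕ.+ n) ≡ fromℕ m + fromℕ n
fromℕ-+ m n = fromℤ-+ (+ m) (+ n)

fromℕ-* : ∀ m n → fromℕ (m ℕ.* n) ≡ fromℕ m * fromℕ n
fromℕ-* m n = trans (cong fromℤ (ℤ.pos-* m n)) (fromℤ-* (+ m) (+ n))

fromℤ-suc : ∀ i → fromℤ (ℤ.suc i) ≡ fromℤ i + 1ℚ
fromℤ-suc i = trans (cong fromℤ (ℤ.+-comm (+ 1) i)) (fromℤ-+ i (+ 1))

-- Induction on `n` for all `k`: Pascal's rule splits the left side, the hypotheses at `k` and
-- `suc k` apply to the pieces, and Pascal's rule joins the results again.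
[k+1]*[n+1]C[k+1]≡[n+1]*nCk : ∀ n k → suc k ℕ.* (suc n C suc k) ≡ suc n ℕ.* (n C k)
[k+1]*[n+1]C[k+1]≡[n+1]*nCk zero    zero    = refl
[k+1]*[n+1]C[k+1]≡[n+1]*nCk zero    (suc k)
  rewrite k>n⇒nCk≡0 {1} {suc (suc k)} (ℕ.s≤s (ℕ.s≤s ℕ.z≤n)) = ℕ.*-zeroʳ k
[k+1]*[n+1]C[k+1]≡[n+1]*nCk (suc n) zero    = begin
  1 ℕ.* (suc (suc n) C 1)  ≡⟨ ℕ.*-identityˡ _ ⟩
  suc (suc n) C 1          ≡⟨ nC1≡n (suc (suc n)) ⟩
  suc (suc n)              ≡⟨ ℕ.*-identityʳ _ ⟨
  suc (suc n) ℕ.* 1        ∎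
[k+1]*[n+1]C[k+1]≡[n+1]*nCk (suc n) (suc k) = begin
  suc (suc k) ℕ.* (suc (suc n) C suc (suc k))
    ≡⟨ cong (suc (suc k) ℕ.*_) (nCk+nC[k+1]≡[n+1]C[k+1] (suc n) (suc k)) ⟨
  suc (suc k) ℕ.* (c ℕ.+ d)
    ≡⟨ expand k c d ⟩
  c ℕ.+ (suc k ℕ.* c ℕ.+ suc (suc k) ℕ.* d)
    ≡⟨ cong (c ℕ.+_) (cong₂ ℕ._+_ ([k+1]*[n+1]C[k+1]≡[n+1]*nCk n k)
                                   ([k+1]*[n+1]C[k+1]≡[n+1]*nCk n (suc k))) ⟩
  c ℕ.+ (suc n ℕ.* (n C k) ℕ.+ suc n ℕ.* (n C suc k))
    ≡⟨ cong (c ℕ.+_) (ℕ.*-distribˡ-+ (suc n) (n C k) (n C suc k)) ⟨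
  c ℕ.+ suc n ℕ.* (n C k ℕ.+ n C suc k)
    ≡⟨ cong (λ e → c ℕ.+ suc n ℕ.* e) (nCk+nC[k+1]≡[n+1]C[k+1] n k) ⟩
  suc (suc n) ℕ.* c
    ∎
  where
  c d : ℕ
  c = suc n C suc k
  d = suc n C suc (suc k)
  open ℕSolver.+-*-Solver
  expand : ∀ k c d → suc (suc k) ℕ.* (c ℕ.+ d) ≡ c ℕ.+ (suc k ℕ.* c ℕ.+ suc (suc k) ℕ.* d)
  expand = solve 3 (λ k c d → (con 2 :+ k) :* (c :+ d)
                              := c :+ ((con 1 :+ k) :* c :+ (con 2 :+ k) :* d)) refl

β : ℕ → ℤ → ℚ
β a i = fromℤ (binom a i)

-- At `i = -1` the rule reads `1 = 0 + 1`, and below that every term is 0; hence no restriction on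
-- the index.
β-pascal : ∀ a i → β (suc a) (ℤ.suc i) ≡ β a i + β a (ℤ.suc i)
β-pascal a (+ k)        =
  trans (cong fromℕ (sym (nCk+nC[k+1]≡[n+1]C[k+1] a k))) (fromℕ-+ (a C k) (a C suc k))
β-pascal a -[1+ 0 ]     = refl
β-pascal a -[1+ suc k ] = refl

-- At `i = -1` the binomial on the right is 1, but its factor `fromℤ i + 1ℚ` vanishes; for smaller
-- `i` both binomials are 0.
β-lower : ∀ a i → (fromℕ a + 1ℚ) * β a i ≡ (fromℤ i + 1ℚ) * β (suc a) (ℤ.suc i)
β-lower a (+ k)        = begin
  (fromℕ a + 1ℚ) * β a (+ k)               ≡⟨ cong (_* β a (+ k)) (fromℤ-suc (+ a)) ⟨
  fromℕ (suc a) * fromℕ (a C k)            ≡⟨ fromℕ-* (suc a) (a C k) ⟨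
  fromℕ (suc a ℕ.* (a C k))                ≡⟨ cong fromℕ ([k+1]*[n+1]C[k+1]≡[n+1]*nCk a k) ⟨
  fromℕ (suc k ℕ.* (suc a C suc k))        ≡⟨ fromℕ-* (suc k) (suc a C suc k) ⟩
  fromℕ (suc k) * fromℕ (suc a C suc k)    ≡⟨ cong (_* fromℕ (suc a C suc k)) (fromℤ-suc (+ k)) ⟩
  (fromℕ k + 1ℚ) * β (suc a) (+ suc k)     ∎
β-lower a -[1+ 0 ]     = *-zeroʳ (fromℕ a + 1ℚ)
β-lower a -[1+ suc k ] = trans (*-zeroʳ (fromℕ a + 1ℚ)) (sym (*-zeroʳ (fromℤ -[1+ suc k ] + 1ℚ)))

-- Pascal's rule writes C(a, i) as C(a+1, i) - C(a, i-1), and `β-lower` turns (a+1) C(a, i-1) into i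
-- C(a+1, i). Every integer is a successor, so it suffices to treat `ℤ.suc j`.
β-raise : ∀ a i → (fromℕ a + 1ℚ) * β a i ≡ (fromℕ a + 1ℚ + - fromℤ i) * β (suc a) i
β-raise a i = subst (λ i → (fromℕ a + 1ℚ) * β a i ≡ (fromℕ a + 1ℚ + - fromℤ i) * β (suc a) i)
                    (ℤ.suc-pred i) (raise-suc (ℤ.pred i))
  where
  open ℚSolver.+-*-Solver
  rearrange : ∀ x y z → x * z ≡ x * (y + z) + - (x * y)
  rearrange = solve 3 (λ x y z → x :* z := x :* (y :+ z) :+ :- (x :* y)) refl
  factor : ∀ x y z → x * z + - (y * z) ≡ (x + - y) * z
  factor = solve 3 (λ x y z → x :* z :+ :- (y :* z) := (x :+ :- y) :* z) refl
  raise-suc : ∀ j → (fromℕ a + 1ℚ) * β a (ℤ.suc j)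
                    ≡ (fromℕ a + 1ℚ + - fromℤ (ℤ.suc j)) * β (suc a) (ℤ.suc j)
  raise-suc j = begin
    x * β a (ℤ.suc j)                                           ≡⟨ rearrange x (β a j) (β a (ℤ.suc j)) ⟩
    x * (β a j + β a (ℤ.suc j)) + - (x * β a j)
      ≡⟨ cong₂ (λ u v → x * u + - v) (sym (β-pascal a j)) (β-lower a j) ⟩
    x * b + - ((fromℤ j + 1ℚ) * b)                              ≡⟨ cong (λ y → x * b + - (y * b)) (fromℤ-suc j) ⟨
    x * b + - (fromℤ (ℤ.suc j) * b)                             ≡⟨ factor x (fromℤ (ℤ.suc j)) b ⟩
    (x + - fromℤ (ℤ.suc j)) * b                                 ∎
    where
    x b : ℚ
    x = fromℕ a + 1ℚ
    b = β (suc a) (ℤ.suc j)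

-- The polynomial identity

-- The coefficient formulas are kept as syntax so that a single text can be evaluated in ℕ (as
-- in a₀, …, c₁), in ℚ, and in the polynomials of the ring solver.

infix  10 #_
infixl 6 _⊕_
infixl 7 _⊗_
infixr 8 _⊛_

data Expr : Set where
  𝕥 𝕟 : Expr
  #_ : ℕ → Expr
  _⊕_ _⊗_ : Expr → Expr → Expr
  _⊛_ : Expr → ℕ → Expr

module Eval {A : Set} (_+_ _*_ : A → A → A) (con : ℕ → A) (τ ν : A) where
  ⟦_⟧ : Expr → A
  ⟦ 𝕥 ⟧         = τ
  ⟦ 𝕟 ⟧         = ν
  ⟦ # k ⟧       = con k
  ⟦ e ⊕ f ⟧     = ⟦ e ⟧ + ⟦ f ⟧
  ⟦ e ⊗ f ⟧     = ⟦ e ⟧ * ⟦ f ⟧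
  -- Powers unfold exactly as `_^_` does, so evaluation in ℕ returns the arguments of `fromℕ` in
  -- `a₀`, ..., `c₁` definitionally.
  ⟦ e ⊛ zero ⟧  = con 1
  ⟦ e ⊛ suc k ⟧ = ⟦ e ⟧ * ⟦ e ⊛ k ⟧

-- Signs and halves are left out, so that everything can be evaluated in ℕ. `aᵉ` is twice the last
-- summand of a₁ and of the bracket in a₂; `bᵉ` and `cᵉ` are twice those of b₁ and c₁; `sᵉ` is the
-- constant factor of the denominator.
a₀ᵉ a₁ᵉ a₂ᵉ aᵉ b₀ᵉ b₁ᵉ bᵉ c₁ᵉ cᵉ sᵉ : Expr
a₀ᵉ = # 2 ⊗ 𝕟 ⊛ 3 ⊕ (# 2 ⊗ 𝕥 ⊕ # 5) ⊗ 𝕟 ⊛ 2 ⊕ (# 2 ⊗ 𝕥 ⊕ # 3) ⊗ 𝕟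
a₁ᵉ = # 2 ⊗ 𝕥 ⊗ (𝕥 ⊕ # 2) ⊗ 𝕟 ⊛ 3 ⊕ # 3 ⊗ 𝕥 ⊗ (𝕥 ⊕ # 2) ⊛ 2 ⊗ 𝕟 ⊛ 2
      ⊕ 𝕥 ⊗ (𝕥 ⊕ # 2) ⊗ (𝕥 ⊛ 2 ⊕ # 5 ⊗ 𝕥 ⊕ # 5) ⊗ 𝕟
a₂ᵉ = (# 2 ⊗ 𝕥 ⊕ # 2) ⊗ 𝕟 ⊛ 3 ⊕ (# 3 ⊗ 𝕥 ⊛ 2 ⊕ # 9 ⊗ 𝕥 ⊕ # 5) ⊗ 𝕟 ⊛ 2
      ⊕ (# 2 ⊗ 𝕥 ⊕ # 3) ⊗ (𝕥 ⊛ 2 ⊕ # 3 ⊗ 𝕥 ⊕ # 1) ⊗ 𝕟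
aᵉ  = 𝕥 ⊗ (𝕥 ⊕ # 1) ⊗ (𝕥 ⊕ # 2) ⊗ (𝕥 ⊕ # 3)
b₀ᵉ = 𝕟 ⊕ # 1
b₁ᵉ = (𝕥 ⊕ # 1) ⊛ 2 ⊗ 𝕟
bᵉ  = (𝕥 ⊕ # 1) ⊗ (𝕥 ⊛ 2 ⊕ # 4 ⊗ 𝕥 ⊕ # 2)
c₁ᵉ = (𝕥 ⊕ # 1) ⊛ 2 ⊗ 𝕟
cᵉ  = 𝕥 ⊗ (𝕥 ⊕ # 1) ⊗ (𝕥 ⊕ # 2)
sᵉ  = (𝕟 ⊕ 𝕥 ⊕ # 3) ⊗ (𝕟 ⊕ # 1)

module Coefficients {A : Set} (_+_ _*_ : A → A → A) (-_ : A → A) (con : ℚ → A) (τ ν : A) where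

  open Eval _+_ _*_ (λ k → con (fromℕ k)) τ ν public

  A₀ A₁ A₂ B₀ B₁ C₀ C₁ S : A
  A₀ = - ⟦ a₀ᵉ ⟧
  A₁ = ⟦ a₁ᵉ ⟧ + (con ½ * ⟦ aᵉ ⟧)
  A₂ = ⟦ 𝕥 ⊕ # 1 ⟧ * (⟦ a₂ᵉ ⟧ + (con ½ * ⟦ aᵉ ⟧))
  B₀ = - ⟦ b₀ᵉ ⟧
  B₁ = ⟦ b₁ᵉ ⟧ + (con ½ * ⟦ bᵉ ⟧)
  C₀ = - ⟦ 𝕟 ⟧
  C₁ = ⟦ c₁ᵉ ⟧ + (con ½ * ⟦ cᵉ ⟧)
  S  = ⟦ sᵉ ⟧

  -- The linear combinations of neighbouring coefficients that make up a coefficient of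
  -- denominator · N_{n+1}, a-numerator · N_n and (x - 1)² (b₀ + b₁ x) · N_{n-1}.
  Dᴸ : A → A → A
  Dᴸ x₁ x₀ = ((S * C₀) * x₁) + ((S * C₁) * x₀)

  Aᴸ : A → A → A → A
  Aᴸ y₂ y₁ y₀ = (A₀ * y₂) + ((A₁ * y₁) + (A₂ * y₀))

  Bᴸ : A → A → A → A → A
  Bᴸ z₃ z₂ z₁ z₀ = δ (δ (b z₃ z₂) (b z₂ z₁)) (δ (b z₂ z₁) (b z₁ z₀))
    where
    b δ : A → A → A
    b u v = (B₀ * u) + (B₁ * v)
    -- Multiplication by `x-1`, left unsimplified to agree with what `coeffᶻ-linear-*` yields.
    δ u v = (con (ℚ.- 1ℚ) * u) + (con 1ℚ * v)

module Factors {A : Set} (_+_ _*_ : A → A → A) (-_ : A → A) (1# : A) where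

  infixl 30 _↑
  _↑ : A → A
  x ↑ = x + 1#

  _-_ : A → A → A
  x - y = x + (- y)

  -- C(a, i+s) / C(a+r, i+r) = fᵣₛ a i / dᵣ a
  d₁ d₂ d₃ : A → A
  d₁ a = a ↑
  d₂ a = a ↑ * d₁ (a ↑)
  d₃ a = a ↑ * d₂ (a ↑)

  f₁₀ f₁₁ f₂₀ f₂₁ f₂₂ f₃₀ f₃₁ f₃₂ f₃₃ : A → A → A
  f₁₀ a i = i ↑
  f₁₁ a i = (a ↑) - (i ↑)
  f₂₀ a i = i ↑ * f₁₀ (a ↑) (i ↑)
  f₂₁ a i = i ↑ ↑ * f₁₁ (a ↑) (i ↑)
  f₂₂ a i = ((a ↑) - (i ↑ ↑)) * f₁₁ (a ↑) (i ↑)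
  f₃₀ a i = i ↑ * f₂₀ (a ↑) (i ↑)
  f₃₁ a i = i ↑ ↑ * f₂₁ (a ↑) (i ↑)
  f₃₂ a i = i ↑ ↑ ↑ * f₂₂ (a ↑) (i ↑)
  f₃₃ a i = ((a ↑) - (i ↑ ↑ ↑)) * f₂₂ (a ↑) (i ↑)

module Terms {A : Set} (_+_ _*_ : A → A → A) (-_ : A → A) (con : ℚ → A) (p τ j : A) where

  open Factors _+_ _*_ -_ (con 1ℚ)

  ν μ : A
  ν = p ↑
  μ = (p + τ) ↑

  open Coefficients _+_ _*_ -_ con τ ν public

  -- The linear factor m + 1 + i t of the closed form.
  ℓ : A → A → A
  ℓ m i = m ↑ + (i * τ)

  -- Up to the common factor W / K introduced below, these are the coefficients of
  -- x^(j+2), x^(j+3) in N_{n+1} (ξ), of x^(j+1), …, x^(j+3) in N_n (η), and of x^j, …, x^(j+3)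
  -- in n (n+t) N_{n-1} (ζ), where n = p + 1.
  ξ₀ ξ₁ η₀ η₁ η₂ ζ₀ ζ₁ ζ₂ ζ₃ : A
  ξ₀ = (ν ↑ * μ ↑) * (ℓ (μ ↑) (j ↑ ↑)   * (f₁₀ (ν ↑ ↑) (j ↑ ↑ ↑) * f₁₀ (μ ↑ ↑) (j ↑ ↑)))
  ξ₁ = (ν ↑ * μ ↑) * (ℓ (μ ↑) (j ↑ ↑ ↑) * (f₁₁ (ν ↑ ↑) (j ↑ ↑ ↑) * f₁₁ (μ ↑ ↑) (j ↑ ↑)))
  η₀ = ℓ μ (j ↑)     * (f₂₀ (ν ↑) (j ↑ ↑) * f₂₀ (μ ↑) (j ↑))
  η₁ = ℓ μ (j ↑ ↑)   * (f₂₁ (ν ↑) (j ↑ ↑) * f₂₁ (μ ↑) (j ↑))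
  η₂ = ℓ μ (j ↑ ↑ ↑) * (f₂₂ (ν ↑) (j ↑ ↑) * f₂₂ (μ ↑) (j ↑))
  ζ₀ = ℓ (p + τ) j         * (f₃₀ ν (j ↑) * f₃₀ μ j)
  ζ₁ = ℓ (p + τ) (j ↑)     * (f₃₁ ν (j ↑) * f₃₁ μ j)
  ζ₂ = ℓ (p + τ) (j ↑ ↑)   * (f₃₂ ν (j ↑) * f₃₂ μ j)
  ζ₃ = ℓ (p + τ) (j ↑ ↑ ↑) * (f₃₃ ν (j ↑) * f₃₃ μ j)

  lhs rhs : A
  lhs = Dᴸ ξ₁ ξ₀
  rhs = Aᴸ η₂ η₁ η₀ + (con (ℚ.- 1ℚ) * Bᴸ ζ₃ ζ₂ ζ₁ ζ₀)

-- The generic `Terms` are instantiated in ℚ and in the solver's polynomials, so the large identity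
-- is never written out; normalisation in the three variables decides it.
lhs≡rhs : ∀ p t j → Terms.lhs _+_ _*_ -_ id p t j ≡ Terms.rhs _+_ _*_ -_ id p t j
lhs≡rhs = solve 3 (λ p t j → lhs _:+_ _:*_ :-_ con p t j := rhs _:+_ _:*_ :-_ con p t j) refl
  where
  open ℚSolver.+-*-Solver
  open Terms using (lhs; rhs)

-- Closed forms of the coefficients

-- A record, so that k, x, c and y can be inferred from a proof.
record Proportion (k x c y : ℚ) : Set where
  constructor proportion
  field equation : k * x ≡ c * y
open Proportion

chain : ∀ {k k′ x y z c c′} → Proportion k x c y → Proportion k′ y c′ z →
        Proportion (k * k′) x (c * c′) z
chain {k} {k′} {x} {y} {z} {c} {c′} (proportion kx≡cy) (proportion k′y≡c′z) = proportion (begin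
  k * k′ * x    ≡⟨ cong (_* x) (*-comm k k′) ⟩
  k′ * k * x    ≡⟨ *-assoc k′ k x ⟩
  k′ * (k * x)  ≡⟨ cong (k′ *_) kx≡cy ⟩
  k′ * (c * y)  ≡⟨ *-assoc k′ c y ⟨
  k′ * c * y    ≡⟨ cong (_* y) (*-comm k′ c) ⟩
  c * k′ * y    ≡⟨ *-assoc c k′ y ⟩
  c * (k′ * y)  ≡⟨ cong (c *_) k′y≡c′z ⟩
  c * (c′ * z)  ≡⟨ *-assoc c c′ z ⟨
  c * c′ * z    ∎)

times : ∀ {k k′ x x′ c c′ y y′} → Proportion k x c y → Proportion k′ x′ c′ y′ →
        Proportion (k * k′) (x * x′) (c * c′) (y * y′)
times {k} {k′} {x} {x′} {c} {c′} {y} {y′} (proportion kx≡cy) (proportion k′x′≡c′y′) = proportion (begin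
  k * k′ * (x * x′)    ≡⟨ *-interchange k k′ x x′ ⟩
  k * x * (k′ * x′)    ≡⟨ cong₂ _*_ kx≡cy k′x′≡c′y′ ⟩
  c * y * (c′ * y′)    ≡⟨ *-interchange c y c′ y′ ⟩
  c * c′ * (y * y′)    ∎)

scale : ∀ s {k x c y} → Proportion k x c y → Proportion (s * k) x (s * c) y
scale s {k} {x} {c} {y} (proportion kx≡cy) = proportion (begin
  s * k * x    ≡⟨ *-assoc s k x ⟩
  s * (k * x)  ≡⟨ cong (s *_) kx≡cy ⟩
  s * (c * y)  ≡⟨ *-assoc s c y ⟨
  s * c * y    ∎)

absorb : ∀ s {k x c y} → Proportion (s * k) x c y → Proportion k (s * x) c y
absorb s {k} {x} {c} {y} (proportion skx≡cy) = proportion (begin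
  k * (s * x)  ≡⟨ *-assoc k s x ⟨
  k * s * x    ≡⟨ cong (_* x) (*-comm k s) ⟩
  s * k * x    ≡⟨ skx≡cy ⟩
  c * y        ∎)

infixr 6 _⊞_
infixr 7 _⊡_

_⊞_ : ∀ {k x x′ c c′ y} → Proportion k x c y → Proportion k x′ c′ y → Proportion k (x + x′) (c + c′) y
_⊞_ {k} {x} {x′} {c} {c′} {y} (proportion kx≡cy) (proportion kx′≡c′y) = proportion (begin
  k * (x + x′)      ≡⟨ *-distribˡ-+ k x x′ ⟩
  k * x + k * x′    ≡⟨ cong₂ _+_ kx≡cy kx′≡c′y ⟩
  c * y + c′ * y    ≡⟨ *-distribʳ-+ y c c′ ⟨
  (c + c′) * y      ∎)

_⊡_ : ∀ s {k x c y} → Proportion k x c y → Proportion k (s * x) (s * c) y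
_⊡_ s {k} {x} {c} {y} kx≡cy = absorb s (scale s kx≡cy)

-- Binomial coefficients as multiples of larger ones

open Factors _+_ _*_ -_ 1ℚ

↑-cong : ∀ {i x} → fromℤ i ≡ x → fromℤ (ℤ.suc i) ≡ x ↑
↑-cong {i} refl = fromℤ-suc i

module _ {α x : ℚ} (a : ℕ) (i : ℤ) (a≡α : fromℕ a ≡ α) (i≡x : fromℤ i ≡ x) where

  -- Restated for any rationals equal to `a` and `i`, so that the factors appear in the form used in
  -- `Terms`, such as `ν ↑ ↑`.
  lower : Proportion (α ↑) (β a i) (x ↑) (β (suc a) (ℤ.suc i))
  lower = proportion (subst₂ (λ α x → α ↑ * β a i ≡ x ↑ * β (suc a) (ℤ.suc i)) a≡α i≡x (β-lower a i))

  raise : Proportion (α ↑) (β a i) (α ↑ + - x) (β (suc a) i)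
  raise = proportion (subst₂ (λ α x → α ↑ * β a i ≡ (α ↑ + - x) * β (suc a) i) a≡α i≡x (β-raise a i))

module _ {α x : ℚ} (a : ℕ) (i : ℤ) (a≡α : fromℕ a ≡ α) (i≡x : fromℤ i ≡ x) where

  private
    i≡x₁ = ↑-cong {i} i≡x
    i₁ = ℤ.suc i

  step₁₀ : Proportion (d₁ α) (β a i) (f₁₀ α x) (β (1 ℕ.+ a) i₁)
  step₁₀ = lower a i a≡α i≡x

  step₁₁ : Proportion (d₁ α) (β a i₁) (f₁₁ α x) (β (1 ℕ.+ a) i₁)
  step₁₁ = raise a i₁ a≡α i≡x₁

module _ {α x : ℚ} (a : ℕ) (i : ℤ) (a≡α : fromℕ a ≡ α) (i≡x : fromℤ i ≡ x) where

  private
    a≡α₁ = ↑-cong {+ a} a≡α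
    i≡x₁ = ↑-cong {i} i≡x
    i≡x₂ = ↑-cong {ℤ.suc i} i≡x₁
    i₁ = ℤ.suc i
    i₂ = ℤ.suc i₁

  -- Here and for three steps, the first step is `lower`, raising both arguments, as long as the
  -- lower index is short of its target, and `raise`, moving the upper argument alone, once it is
  -- there. A shorter chain from `suc a` and `i₁` remains.
  step₂₀ : Proportion (d₂ α) (β a i) (f₂₀ α x) (β (2 ℕ.+ a) i₂)
  step₂₀ = chain (lower a i a≡α i≡x) (step₁₀ (suc a) i₁ a≡α₁ i≡x₁)

  step₂₁ : Proportion (d₂ α) (β a i₁) (f₂₁ α x) (β (2 ℕ.+ a) i₂)
  step₂₁ = chain (lower a i₁ a≡α i≡x₁) (step₁₁ (suc a) i₁ a≡α₁ i≡x₁)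

  step₂₂ : Proportion (d₂ α) (β a i₂) (f₂₂ α x) (β (2 ℕ.+ a) i₂)
  step₂₂ = chain (raise a i₂ a≡α i≡x₂) (step₁₁ (suc a) i₁ a≡α₁ i≡x₁)

module _ {α x : ℚ} (a : ℕ) (i : ℤ) (a≡α : fromℕ a ≡ α) (i≡x : fromℤ i ≡ x) where

  private
    a≡α₁ = ↑-cong {+ a} a≡α
    i≡x₁ = ↑-cong {i} i≡x
    i≡x₂ = ↑-cong {ℤ.suc i} i≡x₁
    i≡x₃ = ↑-cong {ℤ.suc (ℤ.suc i)} i≡x₂
    i₁ = ℤ.suc i
    i₂ = ℤ.suc i₁
    i₃ = ℤ.suc i₂

  step₃₀ : Proportion (d₃ α) (β a i) (f₃₀ α x) (β (3 ℕ.+ a) i₃)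
  step₃₀ = chain (lower a i a≡α i≡x) (step₂₀ (suc a) i₁ a≡α₁ i≡x₁)

  step₃₁ : Proportion (d₃ α) (β a i₁) (f₃₁ α x) (β (3 ℕ.+ a) i₃)
  step₃₁ = chain (lower a i₁ a≡α i≡x₁) (step₂₁ (suc a) i₁ a≡α₁ i≡x₁)

  step₃₂ : Proportion (d₃ α) (β a i₂) (f₃₂ α x) (β (3 ℕ.+ a) i₃)
  step₃₂ = chain (lower a i₂ a≡α i≡x₂) (step₂₂ (suc a) i₁ a≡α₁ i≡x₁)

  step₃₃ : Proportion (d₃ α) (β a i₃) (f₃₃ α x) (β (3 ℕ.+ a) i₃)
  step₃₃ = chain (raise a i₃ a≡α i≡x₃) (step₂₂ (suc a) i₁ a≡α₁ i≡x₁)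

-- Coefficients of N at integer indices

Nᶻ : ℕ → ℕ → ℤ → ℤ
Nᶻ n m i = binom n i ℤ.* binom m i ℤ.- binom n (ℤ.suc i) ℤ.* binom m (ℤ.pred i)

ρ : ℕ → ℕ → ℤ → ℚ
ρ n m i = fromℤ (Nᶻ n m i)

ρ-β : ∀ n m i → ρ n m i ≡ β n i * β m i + - (β n (ℤ.suc i) * β m (ℤ.pred i))
ρ-β n m i = begin
  fromℤ (b ℤ.* c ℤ.+ ℤ.- (d ℤ.* e))              ≡⟨ fromℤ-+ (b ℤ.* c) (ℤ.- (d ℤ.* e)) ⟩
  fromℤ (b ℤ.* c) + fromℤ (ℤ.- (d ℤ.* e))        ≡⟨ cong (_+_ (fromℤ (b ℤ.* c))) (fromℤ-neg (d ℤ.* e)) ⟩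
  fromℤ (b ℤ.* c) + - fromℤ (d ℤ.* e)            ≡⟨ cong₂ (λ x y → x + - y) (fromℤ-* b c) (fromℤ-* d e) ⟩
  fromℤ b * fromℤ c + - (fromℤ d * fromℤ e)      ∎
  where
  b c d e : ℤ
  b = binom n i
  c = binom m i
  d = binom n (ℤ.suc i)
  e = binom m (ℤ.pred i)

-- The factors n+1 and m+1 turn all four binomials into multiples of `U` and `V`. What remains is
-- (x+1)(μ+1-x) - (ν-x)x, in which the squares cancel and μ - ν = τ.
closed-form : ∀ {ν μ τ x} n m i → fromℕ n ≡ ν → fromℕ m ≡ μ → μ ≡ ν + τ → fromℤ i ≡ x →
              Proportion (ν ↑ * μ ↑) (ρ n m i) (μ ↑ + x * τ) (β (suc n) (ℤ.suc i) * β (suc m) i)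
closed-form {ν} {μ} {τ} {x} n m i n≡ν m≡μ refl i≡x = proportion (begin
  ν ↑ * μ ↑ * ρ n m i
    ≡⟨ cong (ν ↑ * μ ↑ *_) (ρ-β n m i) ⟩
  ν ↑ * μ ↑ * (β n i * β m i + - (β n (ℤ.suc i) * β m (ℤ.pred i)))
    ≡⟨ distribute (ν ↑) (μ ↑) (β n i) (β m i) (β n (ℤ.suc i)) (β m (ℤ.pred i)) ⟩
  (ν ↑ * β n i) * (μ ↑ * β m i) + - ((ν ↑ * β n (ℤ.suc i)) * (μ ↑ * β m (ℤ.pred i)))
    ≡⟨ cong₂ (λ y z → y + - z)
         (cong₂ _*_ (equation (lower n i n≡ν i≡x)) (equation (raise m i m≡μ i≡x)))
         (cong₂ _*_ (equation (raise n (ℤ.suc i) n≡ν (↑-cong {i} i≡x))) lower-pred) ⟩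
  (x ↑ * U) * ((μ ↑ + - x) * V) + - (((ν ↑ + - (x ↑)) * U) * (x * V))
    ≡⟨ collect ν τ x U V ⟩
  (μ ↑ + x * τ) * (U * V)
    ∎)
  where
  open ℚSolver.+-*-Solver
  U V : ℚ
  U = β (suc n) (ℤ.suc i)
  V = β (suc m) i
  lower-pred : μ ↑ * β m (ℤ.pred i) ≡ x * V
  lower-pred = begin
    μ ↑ * β m (ℤ.pred i)                                     ≡⟨ equation (lower m (ℤ.pred i) m≡μ refl) ⟩
    fromℤ (ℤ.pred i) ↑ * β (suc m) (ℤ.suc (ℤ.pred i))        ≡⟨ cong (_* β (suc m) (ℤ.suc (ℤ.pred i))) (fromℤ-suc (ℤ.pred i)) ⟨
    fromℤ (ℤ.suc (ℤ.pred i)) * β (suc m) (ℤ.suc (ℤ.pred i))  ≡⟨ cong (λ j → fromℤ j * β (suc m) j) (ℤ.suc-pred i) ⟩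
    fromℤ i * V                                              ≡⟨ cong (_* V) i≡x ⟩
    x * V                                                    ∎
  distribute : ∀ a b c d e f → a * b * (c * d + - (e * f)) ≡ (a * c) * (b * d) + - ((a * e) * (b * f))
  distribute = solve 6 (λ a b c d e f → a :* b :* (c :* d :+ :- (e :* f))
                                        := (a :* c) :* (b :* d) :+ :- ((a :* e) :* (b :* f))) refl
  collect : ∀ ν τ x U V →
            (x ↑ * U) * (((ν + τ) ↑ + - x) * V) + - (((ν ↑ + - (x ↑)) * U) * (x * V))
            ≡ ((ν + τ) ↑ + x * τ) * (U * V)
  collect = solve 5 (λ ν τ x U V → let _↟ = λ y → y :+ con 1ℚ in
    ((x ↟) :* U) :* ((((ν :+ τ) ↟) :+ :- x) :* V) :+ :- ((((ν ↟) :+ :- (x ↟)) :* U) :* (x :* V))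
    := (((ν :+ τ) ↟) :+ x :* τ) :* (U :* V)) refl

-- The recurrence between coefficients

fromℕ-suc≢0 : ∀ {a α} → fromℕ a ≡ α → α + 1ℚ ≢ 0ℚ
fromℕ-suc≢0 {a} refl a+1≡0 with () ← trans (fromℤ-suc (+ a)) a+1≡0

*-≢0 : ∀ {x y} → x ≢ 0ℚ → y ≢ 0ℚ → x * y ≢ 0ℚ
*-≢0 x≢0 y≢0 xy≡0 = y≢0 (*-cancel-0 x≢0 xy≡0)

*-cancelˡ-≢0 : ∀ {k x y} → k ≢ 0ℚ → k * x ≡ k * y → x ≡ y
*-cancelˡ-≢0 {k} {x} {y} k≢0 kx≡ky = x∙y⁻¹≈ε⇒x≈y x y (*-cancel-0 k≢0 (begin
  k * (x + - y)      ≡⟨ *-distribˡ-+ k x (- y) ⟩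
  k * x + k * - y    ≡⟨ cong₂ _+_ kx≡ky (sym (neg-distribʳ-* k y)) ⟩
  k * y + - (k * y)  ≡⟨ +-inverseʳ (k * y) ⟩
  0ℚ                 ∎))
  where open Algebra.Properties.Group +-0-group

module _ (p t : ℕ) (j : ℤ) where

  open Terms _+_ _*_ -_ id (fromℕ p) (fromℕ t) (fromℤ j)

  private
    q : ℕ
    q = p ℕ.+ t
    j₁ j₂ j₃ : ℤ
    j₁ = ℤ.suc j
    j₂ = ℤ.suc j₁
    j₃ = ℤ.suc j₂
    q≡ : fromℕ q ≡ fromℕ p + fromℕ t
    q≡ = fromℕ-+ p t
    n≡ : fromℕ (1 ℕ.+ p) ≡ ν
    n≡ = ↑-cong {+ p} refl
    n≡₁ : fromℕ (2 ℕ.+ p) ≡ ν ↑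
    n≡₁ = ↑-cong {+ (1 ℕ.+ p)} n≡
    n≡₂ : fromℕ (3 ℕ.+ p) ≡ ν ↑ ↑
    n≡₂ = ↑-cong {+ (2 ℕ.+ p)} n≡₁
    m≡ : fromℕ (1 ℕ.+ q) ≡ μ
    m≡ = ↑-cong {+ q} q≡
    m≡₁ : fromℕ (2 ℕ.+ q) ≡ μ ↑
    m≡₁ = ↑-cong {+ (1 ℕ.+ q)} m≡
    m≡₂ : fromℕ (3 ℕ.+ q) ≡ μ ↑ ↑
    m≡₂ = ↑-cong {+ (2 ℕ.+ q)} m≡₁
    j≡₁ : fromℤ j₁ ≡ fromℤ j ↑
    j≡₁ = ↑-cong {j} refl
    j≡₂ : fromℤ j₂ ≡ fromℤ j ↑ ↑
    j≡₂ = ↑-cong {j₁} j≡₁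
    j≡₃ : fromℤ j₃ ≡ fromℤ j ↑ ↑ ↑
    j≡₃ = ↑-cong {j₂} j≡₂
    ↑-+ : ∀ x y → (x + y) ↑ ≡ x ↑ + y
    ↑-+ = let open ℚSolver.+-*-Solver in
          solve 2 (λ x y → (x :+ y) :+ con 1ℚ := (x :+ con 1ℚ) :+ y) refl
    μ≡ : μ ≡ ν + fromℕ t
    μ≡ = ↑-+ (fromℕ p) (fromℕ t)
    μ≡₁ : μ ↑ ≡ ν ↑ + fromℕ t
    μ≡₁ = trans (cong _↑ μ≡) (↑-+ ν (fromℕ t))

  -- With n = p + 1 and m = n + t, `K` is (n+1)(n+2)(n+3)(m+1)(m+2)(m+3) and `W` is C(n+3, j+4)
  -- C(m+3, j+3).
  K W : ℚ
  K = d₃ ν * d₃ μ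
  W = β (4 ℕ.+ p) (ℤ.suc j₃) * β (4 ℕ.+ q) j₃

  K≢0 : K ≢ 0ℚ
  K≢0 = *-≢0 (*-≢0 (fromℕ-suc≢0 n≡) (*-≢0 (fromℕ-suc≢0 n≡₁) (fromℕ-suc≢0 n≡₂)))
             (*-≢0 (fromℕ-suc≢0 m≡) (*-≢0 (fromℕ-suc≢0 m≡₁) (fromℕ-suc≢0 m≡₂)))

  private
    y-K : ∀ {x c} → Proportion ((ν ↑ * μ ↑) * (d₂ (ν ↑) * d₂ (μ ↑))) x c W → Proportion K x c W
    y-K = subst (λ k → Proportion k _ _ W) (*-interchange (ν ↑) (μ ↑) (d₂ (ν ↑)) (d₂ (μ ↑)))

    -- The chain for N_{n+1} is one step shorter than that for N_n: its multiplier lacks the factor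
    -- `ν ↑ * μ ↑` of `K`, which is supplied here and reappears in `ξ₀` and `ξ₁`.
    x-K : ∀ {x c} → Proportion ((ν ↑ ↑ * μ ↑ ↑) * (d₁ (ν ↑ ↑) * d₁ (μ ↑ ↑))) x c W →
          Proportion K x ((ν ↑ * μ ↑) * c) W
    x-K P = y-K (scale (ν ↑ * μ ↑)
              (subst (λ k → Proportion k _ _ W) (*-interchange (ν ↑ ↑) (μ ↑ ↑) (d₁ (ν ↑ ↑)) (d₁ (μ ↑ ↑))) P))

  x₀ : Proportion K (ρ (2 ℕ.+ p) (2 ℕ.+ q) j₂) ξ₀ W
  x₀ = x-K (chain (closed-form (2 ℕ.+ p) (2 ℕ.+ q) j₂ n≡₁ m≡₁ μ≡₁ j≡₂)
                  (times (step₁₀ (3 ℕ.+ p) j₃ n≡₂ j≡₃) (step₁₀ (3 ℕ.+ q) j₂ m≡₂ j≡₂)))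

  x₁ : Proportion K (ρ (2 ℕ.+ p) (2 ℕ.+ q) j₃) ξ₁ W
  x₁ = x-K (chain (closed-form (2 ℕ.+ p) (2 ℕ.+ q) j₃ n≡₁ m≡₁ μ≡₁ j≡₃)
                  (times (step₁₁ (3 ℕ.+ p) j₃ n≡₂ j≡₃) (step₁₁ (3 ℕ.+ q) j₂ m≡₂ j≡₂)))

  y₀ : Proportion K (ρ (1 ℕ.+ p) (1 ℕ.+ q) j₁) η₀ W
  y₀ = y-K (chain (closed-form (1 ℕ.+ p) (1 ℕ.+ q) j₁ n≡ m≡ μ≡ j≡₁)
                  (times (step₂₀ (2 ℕ.+ p) j₂ n≡₁ j≡₂) (step₂₀ (2 ℕ.+ q) j₁ m≡₁ j≡₁)))

  y₁ : Proportion K (ρ (1 ℕ.+ p) (1 ℕ.+ q) j₂) η₁ W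
  y₁ = y-K (chain (closed-form (1 ℕ.+ p) (1 ℕ.+ q) j₂ n≡ m≡ μ≡ j≡₂)
                  (times (step₂₁ (2 ℕ.+ p) j₂ n≡₁ j≡₂) (step₂₁ (2 ℕ.+ q) j₁ m≡₁ j≡₁)))

  y₂ : Proportion K (ρ (1 ℕ.+ p) (1 ℕ.+ q) j₃) η₂ W
  y₂ = y-K (chain (closed-form (1 ℕ.+ p) (1 ℕ.+ q) j₃ n≡ m≡ μ≡ j≡₃)
                  (times (step₂₂ (2 ℕ.+ p) j₂ n≡₁ j≡₂) (step₂₂ (2 ℕ.+ q) j₁ m≡₁ j≡₁)))

  -- The closed form for N_{n-1} contributes the extra multiplier `ν * μ`, that is n (n+t):
  -- precisely the factor in front of N_{n-1} in the recurrence.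
  z₀ : Proportion (ν * μ * K) (ρ p q j) ζ₀ W
  z₀ = chain (closed-form {τ = fromℕ t} p q j refl q≡ refl refl)
             (times (step₃₀ (1 ℕ.+ p) j₁ n≡ j≡₁) (step₃₀ (1 ℕ.+ q) j m≡ refl))

  z₁ : Proportion (ν * μ * K) (ρ p q j₁) ζ₁ W
  z₁ = chain (closed-form p q j₁ refl q≡ refl j≡₁)
             (times (step₃₁ (1 ℕ.+ p) j₁ n≡ j≡₁) (step₃₁ (1 ℕ.+ q) j m≡ refl))

  z₂ : Proportion (ν * μ * K) (ρ p q j₂) ζ₂ W
  z₂ = chain (closed-form p q j₂ refl q≡ refl j≡₂)
             (times (step₃₂ (1 ℕ.+ p) j₁ n≡ j≡₁) (step₃₂ (1 ℕ.+ q) j m≡ refl))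

  z₃ : Proportion (ν * μ * K) (ρ p q j₃) ζ₃ W
  z₃ = chain (closed-form p q j₃ refl q≡ refl j≡₃)
             (times (step₃₃ (1 ℕ.+ p) j₁ n≡ j≡₁) (step₃₃ (1 ℕ.+ q) j m≡ refl))

  Dx : Proportion K (Dᴸ (ρ (2 ℕ.+ p) (2 ℕ.+ q) j₃) (ρ (2 ℕ.+ p) (2 ℕ.+ q) j₂)) (Dᴸ ξ₁ ξ₀) W
  Dx = (S * C₀) ⊡ x₁ ⊞ (S * C₁) ⊡ x₀

  Ay : Proportion K (Aᴸ (ρ (1 ℕ.+ p) (1 ℕ.+ q) j₃) (ρ (1 ℕ.+ p) (1 ℕ.+ q) j₂) (ρ (1 ℕ.+ p) (1 ℕ.+ q) j₁))
                    (Aᴸ η₂ η₁ η₀) W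
  Ay = A₀ ⊡ y₂ ⊞ A₁ ⊡ y₁ ⊞ A₂ ⊡ y₀

  Bz : Proportion (ν * μ * K) (Bᴸ (ρ p q j₃) (ρ p q j₂) (ρ p q j₁) (ρ p q j)) (Bᴸ ζ₃ ζ₂ ζ₁ ζ₀) W
  Bz = δ (δ (b z₃ z₂) (b z₂ z₁)) (δ (b z₂ z₁) (b z₁ z₀))
    where
    b : ∀ {u v c d} → Proportion (ν * μ * K) u c W → Proportion (ν * μ * K) v d W →
        Proportion (ν * μ * K) (B₀ * u + B₁ * v) (B₀ * c + B₁ * d) W
    b u v = B₀ ⊡ u ⊞ B₁ ⊡ v
    δ : ∀ {u v c d} → Proportion (ν * μ * K) u c W → Proportion (ν * μ * K) v d W →
        Proportion (ν * μ * K) (- 1ℚ * u + 1ℚ * v) (- 1ℚ * c + 1ℚ * d) W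
    δ u v = (- 1ℚ) ⊡ u ⊞ 1ℚ ⊡ v

  coefficient-recurrence :
    Dᴸ (ρ (2 ℕ.+ p) (2 ℕ.+ q) j₃) (ρ (2 ℕ.+ p) (2 ℕ.+ q) j₂)
    ≡ Aᴸ (ρ (1 ℕ.+ p) (1 ℕ.+ q) j₃) (ρ (1 ℕ.+ p) (1 ℕ.+ q) j₂) (ρ (1 ℕ.+ p) (1 ℕ.+ q) j₁)
      + - 1ℚ * (ν * μ * Bᴸ (ρ p q j₃) (ρ p q j₂) (ρ p q j₁) (ρ p q j))
  -- `W` may be 0 and is never divided by: after multiplication by `K` both sides are the same
  -- multiple of `W`, and only `K` is cancelled.
  coefficient-recurrence = *-cancelˡ-≢0 K≢0 (begin
    _                                                          ≡⟨ equation Dx ⟩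
    Dᴸ ξ₁ ξ₀ * W                                               ≡⟨ cong (_* W) (lhs≡rhs (fromℕ p) (fromℕ t) (fromℤ j)) ⟩
    (Aᴸ η₂ η₁ η₀ + - 1ℚ * Bᴸ ζ₃ ζ₂ ζ₁ ζ₀) * W                  ≡⟨ equation (Ay ⊞ (- 1ℚ) ⊡ absorb (ν * μ) Bz) ⟨
    _                                                          ∎)

-- Comparison of coefficients

coeffᶻ : Poly → ℤ → ℚ
coeffᶻ p (+ k)    = coeff p k
coeffᶻ p -[1+ _ ] = 0ℚ

coeffᶻ-cong : ∀ {p q} → p ≋ q → ∀ i → coeffᶻ p i ≡ coeffᶻ q i
coeffᶻ-cong p≋q (+ k)    = at p≋q k
coeffᶻ-cong p≋q -[1+ _ ] = refl

coeffᶻ-· : ∀ c p i → coeffᶻ (c · p) i ≡ c * coeffᶻ p i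
coeffᶻ-· c p (+ k)    = coeff-· c p k
coeffᶻ-· c p -[1+ _ ] = sym (*-zeroʳ c)

coeffᶻ-- : ∀ p q i → coeffᶻ (p -ₚ q) i ≡ coeffᶻ p i + - 1ℚ * coeffᶻ q i
coeffᶻ-- p q (+ k)    = trans (coeff-+ p ((- 1ℚ) · q) k) (cong (_+_ (coeff p k)) (coeff-· (- 1ℚ) q k))
coeffᶻ-- p q -[1+ _ ] = refl

-- With zeros at negative indices, the constant coefficient (`i = -1`) obeys the same rule as all
-- others.
coeffᶻ-∷-* : ∀ a p q i → coeffᶻ ((a ∷ p) *ₚ q) (ℤ.suc i) ≡ a * coeffᶻ q (ℤ.suc i) + coeffᶻ (p *ₚ q) i
coeffᶻ-∷-* a p q (+ k)        = coeff-∷-* a p q (suc k)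
coeffᶻ-∷-* a p q -[1+ 0 ]     = coeff-∷-* a p q 0
coeffᶻ-∷-* a p q -[1+ suc k ] = sym (trans (+-identityʳ (a * 0ℚ)) (*-zeroʳ a))

coeffᶻ-constant-* : ∀ a q i → coeffᶻ ((a ∷ []) *ₚ q) i ≡ a * coeffᶻ q i
coeffᶻ-constant-* a q (+ k)    = begin
  coeff ((a ∷ []) *ₚ q) k               ≡⟨ coeff-∷-* a [] q k ⟩
  a * coeff q k + coeff (0ℚ ∷ []) k     ≡⟨ cong (_+_ (a * coeff q k)) (zeros k) ⟩
  a * coeff q k + 0ℚ                    ≡⟨ +-identityʳ (a * coeff q k) ⟩
  a * coeff q k                         ∎
  where
  zeros : ∀ k → coeff (0ℚ ∷ []) k ≡ 0ℚ
  zeros zero    = refl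
  zeros (suc k) = refl
coeffᶻ-constant-* a q -[1+ _ ] = sym (*-zeroʳ a)

coeffᶻ-linear-* : ∀ a b q i → coeffᶻ ((a ∷ b ∷ []) *ₚ q) (ℤ.suc i) ≡ a * coeffᶻ q (ℤ.suc i) + b * coeffᶻ q i
coeffᶻ-linear-* a b q i = trans (coeffᶻ-∷-* a (b ∷ []) q i)
                                (cong (_+_ (a * coeffᶻ q (ℤ.suc i))) (coeffᶻ-constant-* b q i))

coeffᶻ-quadratic-* : ∀ a b c q i → coeffᶻ ((a ∷ b ∷ c ∷ []) *ₚ q) (ℤ.suc (ℤ.suc i))
                     ≡ a * coeffᶻ q (ℤ.suc (ℤ.suc i)) + (b * coeffᶻ q (ℤ.suc i) + c * coeffᶻ q i)
coeffᶻ-quadratic-* a b c q i = trans (coeffᶻ-∷-* a (b ∷ c ∷ []) q (ℤ.suc i))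
                                     (cong (_+_ (a * coeffᶻ q (ℤ.suc (ℤ.suc i)))) (coeffᶻ-linear-* b c q i))

coeff-applyUpTo : ∀ f n → (∀ k → n ℕ.≤ k → f k ≡ 0ℚ) → ∀ k → coeff (applyUpTo f n) k ≡ f k
coeff-applyUpTo f zero    f≡0 k       = sym (f≡0 k ℕ.z≤n)
coeff-applyUpTo f (suc n) f≡0 zero    = refl
coeff-applyUpTo f (suc n) f≡0 (suc k) = coeff-applyUpTo (f ∘ suc) n (λ k n≤k → f≡0 (suc k) (ℕ.s≤s n≤k)) k

N-coeff≡Nᶻ : ∀ n m k → N-coeff n m k ≡ Nᶻ n m (+ k)
N-coeff≡Nᶻ n m k = cong₂ (λ i j → binom n (+ k) ℤ.* binom m (+ k) ℤ.- binom n i ℤ.* binom m j)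
                         (ℤ.+-comm (+ k) (+ 1)) (ℤ.+-comm (+ k) -[1+ 0 ])

Nᶻ-vanishes : ∀ n m k → suc n ℕ.≤ k → Nᶻ n m (+ k) ≡ + 0
Nᶻ-vanishes n m k n<k
  rewrite k>n⇒nCk≡0 n<k | k>n⇒nCk≡0 (ℕ.m<n⇒m<1+n n<k) = refl

-- The list ends at degree n, but beyond it C(n, k) and C(n, k+1) vanish, so the formula is right at
-- every index; at negative ones each product contains a zero binomial.
coeffᶻ-N : ∀ n m i → coeffᶻ (N n m) i ≡ ρ n m i
coeffᶻ-N n m (+ k) = begin
  coeff (N n m) k                   ≡⟨ cong (λ p → coeff p k) (map-upTo f (suc n)) ⟩
  coeff (applyUpTo f (suc n)) k     ≡⟨ coeff-applyUpTo f (suc n) f-vanishes k ⟩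
  fromℤ (N-coeff n m k)             ≡⟨ cong fromℤ (N-coeff≡Nᶻ n m k) ⟩
  ρ n m (+ k)                       ∎
  where
  f : ℕ → ℚ
  f = fromℤ ∘ N-coeff n m
  f-vanishes : ∀ k → suc n ℕ.≤ k → f k ≡ 0ℚ
  f-vanishes k n<k = cong fromℤ (trans (N-coeff≡Nᶻ n m k) (Nᶻ-vanishes n m k n<k))
coeffᶻ-N n m -[1+ k ] = cong fromℤ (sym (cong (λ i → + 0 ℤ.- i) (ℤ.*-zeroʳ (binom n (ℤ.suc -[1+ k ])))))

-- The formulas for a₀, ..., c₁ evaluated in ℚ

module _ (t n : ℕ) {ν : ℚ} (n≡ν : fromℕ n ≡ ν) where

  private module E = Eval ℕ._+_ ℕ._*_ id t n
  open Coefficients _+_ _*_ -_ id (fromℕ t) ν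

  -- The embedding of ℕ in ℚ preserves sums and products. `ν` is any rational equal to n because the
  -- recurrence uses `fromℕ p ↑` for n = p + 1.
  fromℕ-⟦⟧ : ∀ e → fromℕ E.⟦ e ⟧ ≡ ⟦ e ⟧
  fromℕ-⟦⟧ 𝕥           = refl
  fromℕ-⟦⟧ 𝕟           = n≡ν
  fromℕ-⟦⟧ (# k)       = refl
  fromℕ-⟦⟧ (e ⊕ f)     = trans (fromℕ-+ E.⟦ e ⟧ E.⟦ f ⟧) (cong₂ _+_ (fromℕ-⟦⟧ e) (fromℕ-⟦⟧ f))
  fromℕ-⟦⟧ (e ⊗ f)     = trans (fromℕ-* E.⟦ e ⟧ E.⟦ f ⟧) (cong₂ _*_ (fromℕ-⟦⟧ e) (fromℕ-⟦⟧ f))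
  fromℕ-⟦⟧ (e ⊛ zero)  = refl
  fromℕ-⟦⟧ (e ⊛ suc k) = trans (fromℕ-* E.⟦ e ⟧ E.⟦ e ⊛ k ⟧) (cong₂ _*_ (fromℕ-⟦⟧ e) (fromℕ-⟦⟧ (e ⊛ k)))

  private
    half : ∀ e f → fromℕ E.⟦ e ⟧ + ½ * fromℕ E.⟦ f ⟧ ≡ ⟦ e ⟧ + ½ * ⟦ f ⟧
    half e f = cong₂ (λ x y → x + ½ * y) (fromℕ-⟦⟧ e) (fromℕ-⟦⟧ f)

  a-numerator≡ : a-numerator t n ≡ A₀ ∷ A₁ ∷ A₂ ∷ []
  a-numerator≡ = cong₂ _∷_ (cong -_ (fromℕ-⟦⟧ a₀ᵉ)) (cong₂ _∷_ (half a₁ᵉ aᵉ)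
                   (cong (_∷ []) (cong₂ _*_ (fromℕ-⟦⟧ (𝕥 ⊕ # 1)) (half a₂ᵉ aᵉ))))

  b₀∷b₁≡ : b₀ t n ∷ b₁ t n ∷ [] ≡ B₀ ∷ B₁ ∷ []
  b₀∷b₁≡ = cong₂ (λ x y → x ∷ y ∷ []) (cong -_ (fromℕ-⟦⟧ b₀ᵉ)) (half b₁ᵉ bᵉ)

  denominator≡ : denominator t n ≡ S * C₀ ∷ S * C₁ ∷ []
  denominator≡ = cong₂ (λ x y → x ∷ y ∷ []) (cong₂ _*_ (fromℕ-⟦⟧ sᵉ) (cong -_ n≡ν))
                                            (cong₂ _*_ (fromℕ-⟦⟧ sᵉ) (half c₁ᵉ cᵉ))

-- The recurrence between polynomials

module _ (t p : ℕ) where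

  private
    q n : ℕ
    q = p ℕ.+ t
    n = suc p
    n≡ν : fromℕ n ≡ fromℕ p ↑
    n≡ν = fromℤ-suc (+ p)
    σ≡ : fromℕ (n ℕ.* (n ℕ.+ t)) ≡ fromℕ p ↑ * (fromℕ p + fromℕ t) ↑
    σ≡ = trans (fromℕ-* n (n ℕ.+ t)) (cong₂ _*_ n≡ν (↑-cong {+ q} (fromℕ-+ p t)))

  module _ (j : ℤ) where

    open Terms _+_ _*_ -_ id (fromℕ p) (fromℕ t) (fromℤ j)
    private
      j₁ j₂ j₃ : ℤ
      j₁ = ℤ.suc j
      j₂ = ℤ.suc j₁
      j₃ = ℤ.suc j₂

    denominator-coeff : coeffᶻ (denominator t n *ₚ N̲ t (suc n)) j₃
                        ≡ Dᴸ (ρ (suc n) (suc n ℕ.+ t) j₃) (ρ (suc n) (suc n ℕ.+ t) j₂)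
    denominator-coeff = begin
      coeffᶻ (denominator t n *ₚ N̲ t (suc n)) j₃
        ≡⟨ cong (λ d → coeffᶻ (d *ₚ N̲ t (suc n)) j₃) (denominator≡ t n n≡ν) ⟩
      coeffᶻ ((S * C₀ ∷ S * C₁ ∷ []) *ₚ N̲ t (suc n)) j₃
        ≡⟨ coeffᶻ-linear-* (S * C₀) (S * C₁) (N̲ t (suc n)) j₂ ⟩
      Dᴸ (coeffᶻ (N̲ t (suc n)) j₃) (coeffᶻ (N̲ t (suc n)) j₂)
        ≡⟨ cong₂ Dᴸ (coeffᶻ-N (suc n) (suc n ℕ.+ t) j₃) (coeffᶻ-N (suc n) (suc n ℕ.+ t) j₂) ⟩
      Dᴸ (ρ (suc n) (suc n ℕ.+ t) j₃) (ρ (suc n) (suc n ℕ.+ t) j₂)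
        ∎

    a-numerator-coeff : coeffᶻ (a-numerator t n *ₚ N̲ t n) j₃
                        ≡ Aᴸ (ρ n (n ℕ.+ t) j₃) (ρ n (n ℕ.+ t) j₂) (ρ n (n ℕ.+ t) j₁)
    a-numerator-coeff = begin
      coeffᶻ (a-numerator t n *ₚ N̲ t n) j₃
        ≡⟨ cong (λ a → coeffᶻ (a *ₚ N̲ t n) j₃) (a-numerator≡ t n n≡ν) ⟩
      coeffᶻ ((A₀ ∷ A₁ ∷ A₂ ∷ []) *ₚ N̲ t n) j₃
        ≡⟨ coeffᶻ-quadratic-* A₀ A₁ A₂ (N̲ t n) j₁ ⟩
      Aᴸ (coeffᶻ (N̲ t n) j₃) (coeffᶻ (N̲ t n) j₂) (coeffᶻ (N̲ t n) j₁)
        ≡⟨ cong₂ (λ y y′ → Aᴸ y y′ (coeffᶻ (N̲ t n) j₁)) (coeffᶻ-N n (n ℕ.+ t) j₃) (coeffᶻ-N n (n ℕ.+ t) j₂) ⟩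
      Aᴸ (ρ n (n ℕ.+ t) j₃) (ρ n (n ℕ.+ t) j₂) (coeffᶻ (N̲ t n) j₁)
        ≡⟨ cong (Aᴸ (ρ n (n ℕ.+ t) j₃) (ρ n (n ℕ.+ t) j₂)) (coeffᶻ-N n (n ℕ.+ t) j₁) ⟩
      Aᴸ (ρ n (n ℕ.+ t) j₃) (ρ n (n ℕ.+ t) j₂) (ρ n (n ℕ.+ t) j₁)
        ∎

    b-numerator-coeff : coeffᶻ (b-numerator t n *ₚ N̲ t p) j₃
                        ≡ ν * μ * Bᴸ (ρ p q j₃) (ρ p q j₂) (ρ p q j₁) (ρ p q j)
    b-numerator-coeff = begin
      coeffᶻ (b-numerator t n *ₚ N̲ t p) j₃
        ≡⟨ coeffᶻ-cong (·-*ₚ-assoc (fromℕ (n ℕ.* (n ℕ.+ t))) (x-1 *ₚ x-1 *ₚ b) (N̲ t p)) j₃ ⟩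
      coeffᶻ (fromℕ (n ℕ.* (n ℕ.+ t)) · ((x-1 *ₚ x-1 *ₚ b) *ₚ N̲ t p)) j₃
        ≡⟨ coeffᶻ-· (fromℕ (n ℕ.* (n ℕ.+ t))) ((x-1 *ₚ x-1 *ₚ b) *ₚ N̲ t p) j₃ ⟩
      fromℕ (n ℕ.* (n ℕ.+ t)) * coeffᶻ ((x-1 *ₚ x-1 *ₚ b) *ₚ N̲ t p) j₃
        -- With both factors `x-1` outermost, the rule for linear factors can be applied three times
        -- in turn.
        ≡⟨ cong₂ _*_ σ≡ (coeffᶻ-cong reassociate j₃) ⟩
      ν * μ * coeffᶻ (x-1 *ₚ (x-1 *ₚ (b *ₚ N̲ t p))) j₃
        ≡⟨ cong (ν * μ *_) (δδ-coeff (b *ₚ N̲ t p)) ⟩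
      ν * μ * δ (δ (g j₃) (g j₂)) (δ (g j₂) (g j₁))
        ≡⟨ cong (ν * μ *_) (cong₂ δ (cong₂ δ (g-coeff j₂) (g-coeff j₁)) (cong₂ δ (g-coeff j₁) (g-coeff j))) ⟩
      ν * μ * Bᴸ (ρ p q j₃) (ρ p q j₂) (ρ p q j₁) (ρ p q j)
        ∎
      where
      b : Poly
      b = b₀ t n ∷ b₁ t n ∷ []
      δ : ℚ → ℚ → ℚ
      δ u v = - 1ℚ * u + 1ℚ * v
      g : ℤ → ℚ
      g = coeffᶻ (b *ₚ N̲ t p)
      reassociate : (x-1 *ₚ x-1 *ₚ b) *ₚ N̲ t p ≋ x-1 *ₚ (x-1 *ₚ (b *ₚ N̲ t p))
      reassociate = ≋.trans (*ₚ-assoc (x-1 *ₚ x-1) b (N̲ t p)) (*ₚ-assoc x-1 x-1 (b *ₚ N̲ t p))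
      δ-coeff : ∀ r i → coeffᶻ (x-1 *ₚ r) (ℤ.suc i) ≡ δ (coeffᶻ r (ℤ.suc i)) (coeffᶻ r i)
      δ-coeff = coeffᶻ-linear-* (- 1ℚ) 1ℚ
      δδ-coeff : ∀ r → coeffᶻ (x-1 *ₚ (x-1 *ₚ r)) j₃
                       ≡ δ (δ (coeffᶻ r j₃) (coeffᶻ r j₂)) (δ (coeffᶻ r j₂) (coeffᶻ r j₁))
      δδ-coeff r = trans (δ-coeff (x-1 *ₚ r) j₂) (cong₂ δ (δ-coeff r j₂) (δ-coeff r j₁))
      g-coeff : ∀ i → g (ℤ.suc i) ≡ B₀ * ρ p q (ℤ.suc i) + B₁ * ρ p q i
      g-coeff i = begin
        coeffᶻ (b *ₚ N̲ t p) (ℤ.suc i)                             ≡⟨ cong (λ b → coeffᶻ (b *ₚ N̲ t p) (ℤ.suc i)) (b₀∷b₁≡ t n n≡ν) ⟩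
        coeffᶻ ((B₀ ∷ B₁ ∷ []) *ₚ N̲ t p) (ℤ.suc i)                ≡⟨ coeffᶻ-linear-* B₀ B₁ (N̲ t p) i ⟩
        B₀ * coeffᶻ (N̲ t p) (ℤ.suc i) + B₁ * coeffᶻ (N̲ t p) i     ≡⟨ cong₂ (λ u v → B₀ * u + B₁ * v) (coeffᶻ-N p q (ℤ.suc i)) (coeffᶻ-N p q i) ⟩
        B₀ * ρ p q (ℤ.suc i) + B₁ * ρ p q i                       ∎

    polynomial-recurrence-coeffᶻ :
      coeffᶻ (denominator t n *ₚ N̲ t (suc n)) j₃
      ≡ coeffᶻ (a-numerator t n *ₚ N̲ t n -ₚ b-numerator t n *ₚ N̲ t p) j₃
    polynomial-recurrence-coeffᶻ = begin
      coeffᶻ (denominator t n *ₚ N̲ t (suc n)) j₃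
        ≡⟨ denominator-coeff ⟩
      Dᴸ (ρ (suc n) (suc n ℕ.+ t) j₃) (ρ (suc n) (suc n ℕ.+ t) j₂)
        ≡⟨ coefficient-recurrence p t j ⟩
      Aᴸ (ρ n (n ℕ.+ t) j₃) (ρ n (n ℕ.+ t) j₂) (ρ n (n ℕ.+ t) j₁)
        + - 1ℚ * (ν * μ * Bᴸ (ρ p q j₃) (ρ p q j₂) (ρ p q j₁) (ρ p q j))
        ≡⟨ cong₂ (λ y z → y + - 1ℚ * z) a-numerator-coeff b-numerator-coeff ⟨
      coeffᶻ (a-numerator t n *ₚ N̲ t n) j₃ + - 1ℚ * coeffᶻ (b-numerator t n *ₚ N̲ t p) j₃
        ≡⟨ coeffᶻ-- (a-numerator t n *ₚ N̲ t n) (b-numerator t n *ₚ N̲ t p) j₃ ⟨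
      coeffᶻ (a-numerator t n *ₚ N̲ t n -ₚ b-numerator t n *ₚ N̲ t p) j₃
        ∎

  polynomial-recurrence :
    denominator t n *ₚ N̲ t (suc n) ≋ a-numerator t n *ₚ N̲ t n -ₚ b-numerator t n *ₚ N̲ t p
  polynomial-recurrence = coeffwise λ where
    -- The index `j` is the degree minus 3, so degrees 0, 1 and 2 come from negative `j`.
    0                   → polynomial-recurrence-coeffᶻ -[1+ 2 ]
    1                   → polynomial-recurrence-coeffᶻ -[1+ 1 ]
    2                   → polynomial-recurrence-coeffᶻ -[1+ 0 ]
    (suc (suc (suc k))) → polynomial-recurrence-coeffᶻ (+ k)

theorem4p3 : (t n : ℕ) .{{_ : NonZero n}} →
    fromPoly (N̲ t (suc n))
    ≃ (a-numerator t n / denominator t n) *ᵣ fromPoly (N̲ t n)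
    -ᵣ (b-numerator t n / denominator t n) *ᵣ fromPoly (N̲ t (pred n))
theorem4p3 t n@(suc p) =
  cross-multiply (denominator t n) (a-numerator t n) (b-numerator t n)
                 (N̲ t (suc n)) (N̲ t n) (N̲ t p) (polynomial-recurrence t p)
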